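{- Let $\star\in\{\boxtimes,\circ\}$, let $G,H$ be graphs with non-empty edge sets, and let $M_G\subseteq E_G$, $M_H\subseteq E_H$. The following are equivalent: (1) $F_{\ast}(M_G,M_H)$ is a maximum $1$-matching of $G\star H$; (2) $M_G$ is a perfect $1$-matching of $G$ and $M_H$ is a perfect $1$-matching of $H$; (3) $F_{\ast}(M_G,M_H)$ is a perfect $1$-matching of $G\star H$.
   Context: Graphs are finite, simple, undirected. A $1$-matching of $G$ is a set of pairwise vertex-disjoint edges; it is maximum if it has largest cardinality among $1$-matchings of $G$, and perfect if every vertex is incident to one of its edges. Products on $V_G\times V_H$: in $G\boxtimes H$, $(g,h)\sim(g',h')$ iff (i) $\{g,g'\}\in E_G$, $h=h'$; or (ii) $g=g'$, $\{h,h'\}\in E_H$; or (iii) $\{g,g'\}\in E_G$ and $\{h,h'\}\in E_H$; in $G\circ H$ iff $\{g,g'\}\in E_G$ or (ii). $F_{\ast}(M_G,M_H)=\{\{(g,h),(g',h')\}:\{g,g'\}\in M_G,\{h,h'\}\in M_H\}$. -}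

module Defs where

open import Data.Fin as Fin using (Fin)
open import Data.Fin.Properties as Fin using (*↔×; inj⇒≟)
open import Data.List using (List; map; filter; length; allFin; cartesianProduct)
open import Data.Nat using (ℕ; _*_; _≤_)
open import Data.Product using (∃; ∃₂; _×_; _,_; proj₁; proj₂)
open import Data.Product.Function.NonDependent.Propositional using (_×-↔_)
open import Data.Sum using (_⊎_; inj₁; inj₂)
open import Function using (_↔_; Inverse)
open import Function.Construct.Composition using (_↔-∘_)
open import Function.Construct.Symmetry using (↔-sym)
open import Function.Properties.Inverse using (↔⇒↣)
open import Level using (0ℓ)
open import Relation.Binary using (Rel; Symmetric; Decidable; DecidableEquality)
open import Relation.Binary.PropositionalEquality using (_≡_; _≢_; sym)
open import Relation.Nullary using (¬_; Dec)
open import Relation.Nullary.Decidable using (_×-dec_; _⊎-dec_)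

record Finite (V : Set) : Set where
  field
    size : ℕ
    enum : V ↔ Fin size

  index : V → Fin size
  index = Inverse.to enum

  elements : List V
  elements = map (Inverse.from enum) (allFin size)

  _≟_ : DecidableEquality V
  _≟_ = inj⇒≟ (↔⇒↣ enum)

×-finite : ∀ {V W} → Finite V → Finite W → Finite (V × W)
×-finite fV fW = record
  { size = Finite.size fV * Finite.size fW
  ; enum = ↔-sym *↔× ↔-∘ (Finite.enum fV ×-↔ Finite.enum fW)
  }

-- A set of two-element subsets of V: {u , v} belongs to the set iff Adj u v.
record EdgeSet (V : Set) : Set₁ where
  field
    Adj    : Rel V 0ℓ
    symm   : Symmetric Adj
    irrefl : ∀ {v} → ¬ Adj v v
    adj?   : Decidable Adj

open EdgeSet public

_⊆ₑ_ : ∀ {V} → EdgeSet V → EdgeSet V → Set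
M ⊆ₑ N = ∀ {u v} → Adj M u v → Adj N u v

NonEmpty : ∀ {V} → EdgeSet V → Set
NonEmpty M = ∃₂ λ u v → Adj M u v

-- Each edge {u , v} is counted once, through its representative (u , v) in
-- which u precedes v in the enumeration of V.
card : ∀ {V} → Finite V → EdgeSet V → ℕ
card {V} fin M = length (filter edge? (cartesianProduct elements elements))
  where
  open Finite fin

  edge? : (p : V × V) → Dec (index (proj₁ p) Fin.< index (proj₂ p) × Adj M (proj₁ p) (proj₂ p))
  edge? (u , v) = (index u Fin.<? index v) ×-dec adj? M u v

record Graph : Set₁ where
  field
    V      : Set
    finite : Finite V
    E      : EdgeSet V

open Graph public

-- {u , v} = {u′ , v′} as unordered pairs.
SameEdge : ∀ {V : Set} → V × V → V × V → Set
SameEdge (u , v) (u′ , v′) = (u ≡ u′ × v ≡ v′) ⊎ (u ≡ v′ × v ≡ u′)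

VertexDisjoint : ∀ {V : Set} → V × V → V × V → Set
VertexDisjoint (u , v) (u′ , v′) = u ≢ u′ × u ≢ v′ × v ≢ u′ × v ≢ v′

record IsMatching (G : Graph) (M : EdgeSet (V G)) : Set where
  field
    edges    : M ⊆ₑ E G
    disjoint : ∀ {u v u′ v′} → Adj M u v → Adj M u′ v′ →
               ¬ SameEdge (u , v) (u′ , v′) → VertexDisjoint (u , v) (u′ , v′)

record IsMaximumMatching (G : Graph) (M : EdgeSet (V G)) : Set₁ where
  field
    isMatching : IsMatching G M
    largest    : ∀ N → IsMatching G N → card (finite G) N ≤ card (finite G) M

record IsPerfectMatching (G : Graph) (M : EdgeSet (V G)) : Set where
  field
    isMatching : IsMatching G M
    covers     : ∀ v → ∃ λ w → Adj M v w

-- The strong product ⊠ and the lexicographic product ∘.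
data ProductKind : Set where
  ⊠ ∘ : ProductKind

productEdges : ProductKind → (G H : Graph) → EdgeSet (V G × V H)
productEdges ⊠ G H = record
  { Adj    = λ (g , h) (g′ , h′) →
               (Adj (E G) g g′ × h ≡ h′)
               ⊎ (g ≡ g′ × Adj (E H) h h′)
               ⊎ (Adj (E G) g g′ × Adj (E H) h h′)
  ; symm   = λ { (inj₁ (e , p))        → inj₁ (symm (E G) e , sym p)
               ; (inj₂ (inj₁ (p , f))) → inj₂ (inj₁ (sym p , symm (E H) f))
               ; (inj₂ (inj₂ (e , f))) → inj₂ (inj₂ (symm (E G) e , symm (E H) f))
               }
  ; irrefl = λ { (inj₁ (e , _))        → irrefl (E G) e
               ; (inj₂ (inj₁ (_ , f))) → irrefl (E H) f
               ; (inj₂ (inj₂ (e , _))) → irrefl (E G) e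
               }
  ; adj?   = λ (g , h) (g′ , h′) →
               (adj? (E G) g g′ ×-dec (h ≟ᴴ h′))
               ⊎-dec ((g ≟ᴳ g′) ×-dec adj? (E H) h h′)
               ⊎-dec (adj? (E G) g g′ ×-dec adj? (E H) h h′)
  }
  where
  open Finite (finite G) using () renaming (_≟_ to _≟ᴳ_)
  open Finite (finite H) using () renaming (_≟_ to _≟ᴴ_)
productEdges ∘ G H = record
  { Adj    = λ (g , h) (g′ , h′) →
               Adj (E G) g g′ ⊎ (g ≡ g′ × Adj (E H) h h′)
  ; symm   = λ { (inj₁ e)       → inj₁ (symm (E G) e)
               ; (inj₂ (p , f)) → inj₂ (sym p , symm (E H) f)
               }
  ; irrefl = λ { (inj₁ e)       → irrefl (E G) e
               ; (inj₂ (_ , f)) → irrefl (E H) f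
               }
  ; adj?   = λ (g , h) (g′ , h′) →
               adj? (E G) g g′ ⊎-dec ((g ≟ᴳ g′) ×-dec adj? (E H) h h′)
  }
  where
  open Finite (finite G) using () renaming (_≟_ to _≟ᴳ_)

infixl 7 _⟨_⟩_

_⟨_⟩_ : Graph → ProductKind → Graph → Graph
G ⟨ ⋆ ⟩ H = record
  { V      = V G × V H
  ; finite = ×-finite (finite G) (finite H)
  ; E      = productEdges ⋆ G H
  }

F⁎ : ∀ {V W} → EdgeSet V → EdgeSet W → EdgeSet (V × W)
F⁎ M N = record
  { Adj    = λ (g , h) (g′ , h′) → Adj M g g′ × Adj N h h′
  ; symm   = λ (e , f) → symm M e , symm N f
  ; irrefl = λ (e , _) → irrefl M e
  ; adj?   = λ (g , h) (g′ , h′) → adj? M g g′ ×-dec adj? N h h′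
  }

{-# OPTIONS --safe #-}

-- In any graph, twice the size of a matching is the number of vertices it
-- covers, because each vertex has degree 0 or 1 in it.  Hence a perfect matching
-- is maximum, and a maximum matching covers an end of every edge.  Every fibre
-- {g} × H and G × {h} of the product contains an edge, so if F⁎ MG MH is maximum
-- it covers a vertex in each fibre; thus MG covers g and MH covers h.  Finally,
-- fixing an edge of one factor of F⁎ transfers disjointness to the other factor.
module Submission where

open import Defs
open import Algebra.Properties.CommutativeSemigroup using (interchange)
open import Data.Empty using (⊥-elim)
open import Data.Fin as Fin using ()
import Data.Fin.Properties as Fin
open import Data.List using (List; []; _∷_; _++_; map; filter; length; cartesianProduct)
open import Data.List.Membership.Propositional using (_∈_; lose)
open import Data.List.Membership.Propositional.Properties
  using (∈-map⁺; ∈-allFin; ∈-filter⁺; ∈-filter⁻; ∈-length)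
open import Data.List.Properties using (filter-++; length-++; map-∘)
open import Data.List.Relation.Unary.All using (_∷_)
open import Data.List.Relation.Unary.Any using (here; there; any?; satisfied)
open import Data.List.Relation.Unary.Unique.Propositional using (Unique; _∷_)
import Data.List.Relation.Unary.Unique.Propositional.Properties as Unique
open import Data.Nat using (ℕ; suc; _+_; _≤_; _<_; z≤n; s≤s)
open import Data.Nat.ListAction using (sum)
open import Data.Nat.Properties
  using (≤-trans; <⇒≱; ≰⇒>; ≮⇒≥; +-mono-≤; +-mono-<; +-mono-≤-<; +-mono-<-≤; _<?_;
         +-commutativeSemigroup; module ≤-Reasoning)
open import Data.Product using (_×_; ∃; _,_; proj₁; proj₂)
open import Data.Sum using (_⊎_; inj₁; inj₂)
open import Function using (_⇔_; Inverse; mk⇔; _∘′_)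
open import Level using (0ℓ)
open import Relation.Binary using (tri<; tri≈; tri>)
open import Relation.Binary.PropositionalEquality
  using (_≡_; _≢_; refl; sym; trans; cong; cong₂; subst; module ≡-Reasoning)
open import Relation.Nullary using (¬_; Dec; yes; no)
open import Relation.Nullary.Decidable using (_×-dec_; _⊎-dec_; decidable-stable)
open import Relation.Unary using (Pred; Decidable)

private
  variable
    A B : Set

-- Finite sums and counting

∑ : List A → (A → ℕ) → ℕ
∑ xs f = sum (map f xs)

∑-cong : (xs : List A) {f g : A → ℕ} → (∀ x → f x ≡ g x) → ∑ xs f ≡ ∑ xs g
∑-cong []       eq = refl
∑-cong (x ∷ xs) eq = cong₂ _+_ (eq x) (∑-cong xs eq)

∑-zero : (xs : List A) → ∑ xs (λ _ → 0) ≡ 0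
∑-zero []       = refl
∑-zero (_ ∷ xs) = ∑-zero xs

∑-+ : (xs : List A) (f g : A → ℕ) → ∑ xs (λ x → f x + g x) ≡ ∑ xs f + ∑ xs g
∑-+ []       f g = refl
∑-+ (x ∷ xs) f g = trans (cong (f x + g x +_) (∑-+ xs f g))
                         (interchange +-commutativeSemigroup (f x) (g x) (∑ xs f) (∑ xs g))

∑-swap : (xs : List A) (ys : List B) (f : A → B → ℕ) →
         ∑ xs (λ x → ∑ ys (f x)) ≡ ∑ ys (λ y → ∑ xs (λ x → f x y))
∑-swap []       ys f = sym (∑-zero ys)
∑-swap (x ∷ xs) ys f = trans (cong (∑ ys (f x) +_) (∑-swap xs ys f))
                             (sym (∑-+ ys (f x) _))

∑-mono-≤ : (xs : List A) {f g : A → ℕ} → (∀ x → f x ≤ g x) → ∑ xs f ≤ ∑ xs g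
∑-mono-≤ []       le = z≤n
∑-mono-≤ (x ∷ xs) le = +-mono-≤ (le x) (∑-mono-≤ xs le)

∑-mono-< : ∀ {xs : List A} {a} {f g : A → ℕ} → (∀ x → f x ≤ g x) →
           a ∈ xs → f a < g a → ∑ xs f < ∑ xs g
∑-mono-< {xs = _ ∷ xs} le (here refl) lt = +-mono-<-≤ lt (∑-mono-≤ xs le)
∑-mono-< {xs = x ∷ _}  le (there a∈)  lt = +-mono-≤-< (le x) (∑-mono-< le a∈ lt)

indicator : {P : Set} → Dec P → ℕ
indicator (yes _) = 1
indicator (no _)  = 0

length-filter-∑ : {P : Pred A 0ℓ} (P? : Decidable P) (xs : List A) →
                  length (filter P? xs) ≡ ∑ xs (λ x → indicator (P? x))
length-filter-∑ P? []       = refl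
length-filter-∑ P? (x ∷ xs) with P? x
... | yes _ = cong suc (length-filter-∑ P? xs)
... | no  _ = length-filter-∑ P? xs

length-filter-map : {P : Pred B 0ℓ} (P? : Decidable P) (f : A → B) (xs : List A) →
                    length (filter P? (map f xs)) ≡ ∑ xs (λ x → indicator (P? (f x)))
length-filter-map P? f xs = trans (length-filter-∑ P? (map f xs)) (cong sum (sym (map-∘ xs)))

length-filter-cartesianProduct :
  {P : Pred (A × B) 0ℓ} (P? : Decidable P) (xs : List A) (ys : List B) →
  length (filter P? (cartesianProduct xs ys)) ≡ ∑ xs (λ x → ∑ ys (λ y → indicator (P? (x , y))))
length-filter-cartesianProduct P? []       ys = refl
length-filter-cartesianProduct P? (x ∷ xs) ys = begin
  length (filter P? (map (x ,_) ys ++ rest))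
    ≡⟨ cong length (filter-++ P? (map (x ,_) ys) rest) ⟩
  length (filter P? (map (x ,_) ys) ++ filter P? rest)
    ≡⟨ length-++ (filter P? (map (x ,_) ys)) ⟩
  length (filter P? (map (x ,_) ys)) + length (filter P? rest)
    ≡⟨ cong₂ _+_ (length-filter-map P? (x ,_) ys) (length-filter-cartesianProduct P? xs ys) ⟩
  ∑ (x ∷ xs) (λ x′ → ∑ ys (λ y → indicator (P? (x′ , y)))) ∎
  where
  open ≡-Reasoning
  rest = cartesianProduct xs ys

length≤1 : {xs : List A} → Unique xs → (∀ {x y} → x ∈ xs → y ∈ xs → x ≡ y) → length xs ≤ 1
length≤1 {xs = []}        _                 _  = z≤n
length≤1 {xs = _ ∷ []}    _                 _  = s≤s z≤n
length≤1 {xs = _ ∷ _ ∷ _} ((x≢y ∷ _) ∷ _) eq = ⊥-elim (x≢y (eq (here refl) (there (here refl))))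

+-self-cancel-≤ : ∀ {m n} → m + m ≤ n + n → m ≤ n
+-self-cancel-≤ le = ≮⇒≥ (λ n<m → <⇒≱ (+-mono-< n<m n<m) le)

+-self-cancel-< : ∀ {m n} → m + m < n + n → m < n
+-self-cancel-< lt = ≰⇒> (λ n≤m → <⇒≱ lt (+-mono-≤ n≤m n≤m))

-- Edge sets and degrees

Covers : EdgeSet A → A → Set
Covers M u = ∃ λ v → Adj M u v

-- The working form of the matching condition: at most one edge at each vertex. It bounds degrees
-- directly and avoids reasoning about distinct edges through `SameEdge`.
Functional : EdgeSet A → Set
Functional M = ∀ {u v w} → Adj M u v → Adj M u w → v ≡ w

module _ {V : Set} (fin : Finite V) where
  open Finite fin

  from∘index : ∀ v → Inverse.from enum (index v) ≡ v
  from∘index v = Inverse.inverseʳ enum refl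

  index-injective : ∀ {u v} → index u ≡ index v → u ≡ v
  index-injective {u} {v} eq =
    trans (sym (from∘index u)) (trans (cong (Inverse.from enum) eq) (from∘index v))

  ∈-elements : ∀ v → v ∈ elements
  ∈-elements v = subst (_∈ elements) (from∘index v) (∈-map⁺ (Inverse.from enum) (∈-allFin (index v)))

  elements-unique : Unique elements
  elements-unique = Unique.map⁺ from-injective (Unique.allFin⁺ size)
    where
    from-injective : ∀ {i j} → Inverse.from enum i ≡ Inverse.from enum j → i ≡ j
    from-injective eq =
      trans (sym (Inverse.inverseˡ enum refl)) (trans (cong index eq) (Inverse.inverseˡ enum refl))

  covers? : (M : EdgeSet V) → Decidable (Covers M)
  covers? M u with any? (adj? M u) elements
  ... | yes p = yes (satisfied p)
  ... | no ¬p = no (λ (v , e) → ¬p (lose (∈-elements v) e))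

  degree : EdgeSet V → V → ℕ
  degree M u = length (filter (adj? M u) elements)

  degree≤1 : ∀ M → Functional M → ∀ u → degree M u ≤ 1
  degree≤1 M fun u = length≤1 (Unique.filter⁺ (adj? M u) elements-unique)
    (λ v∈ w∈ → fun (proj₂ (∈-filter⁻ (adj? M u) {xs = elements} v∈))
                   (proj₂ (∈-filter⁻ (adj? M u) {xs = elements} w∈)))

  covers⇒degree>0 : ∀ M {u} → Covers M u → 0 < degree M u
  covers⇒degree>0 M {u} (v , e) = ∈-length (∈-filter⁺ (adj? M u) (∈-elements v) e)

  degree>0⇒covers : ∀ M {u} → 0 < degree M u → Covers M u
  degree>0⇒covers M {u} = nonempty (filter (adj? M u) elements)
    (λ v∈ → proj₂ (∈-filter⁻ (adj? M u) {xs = elements} v∈))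
    where
    nonempty : ∀ xs → (∀ {v} → v ∈ xs → Adj M u v) → 0 < length xs → Covers M u
    nonempty (v ∷ _) adj _ = v , adj (here refl)

  -- Double counting of ordered adjacent pairs: `card` counts those with increasing index, and by
  -- symmetry of `M` equally many have decreasing index.
  handshake : ∀ M → card fin M + card fin M ≡ ∑ elements (degree M)
  handshake M = begin
    card fin M + card fin M
      -- Only the second copy has its summations swapped, so that `up u v` and `up v u` meet under
      -- the same pair of sums.
      ≡⟨ cong₂ _+_ card-∑ (trans card-∑ (∑-swap elements elements up)) ⟩
    ∑ elements (λ u → ∑ elements (up u)) + ∑ elements (λ u → ∑ elements (λ v → up v u))
      ≡⟨ ∑-+ elements (λ u → ∑ elements (up u)) _ ⟨
    ∑ elements (λ u → ∑ elements (up u) + ∑ elements (λ v → up v u))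
      ≡⟨ ∑-cong elements (λ u → ∑-+ elements (up u) _) ⟨
    ∑ elements (λ u → ∑ elements (λ v → up u v + up v u))
      ≡⟨ ∑-cong elements (λ u → ∑-cong elements (up+down u)) ⟩
    ∑ elements (λ u → ∑ elements (λ v → indicator (adj? M u v)))
      ≡⟨ ∑-cong elements (λ u → length-filter-∑ (adj? M u) elements) ⟨
    ∑ elements (degree M) ∎
    where
    open ≡-Reasoning

    up : V → V → ℕ
    up u v = indicator ((index u Fin.<? index v) ×-dec adj? M u v)

    card-∑ : card fin M ≡ ∑ elements (λ u → ∑ elements (up u))
    card-∑ = length-filter-cartesianProduct _ elements elements

    up+down : ∀ u v → up u v + up v u ≡ indicator (adj? M u v)
    up+down u v with index u Fin.<? index v | index v Fin.<? index u | adj? M u v | adj? M v u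
    ... | yes p | yes q | _     | _     = ⊥-elim (Fin.<-asym p q)
    ... | yes _ | no  _ | yes _ | _     = refl
    ... | yes _ | no  _ | no  _ | _     = refl
    ... | no  _ | yes _ | yes _ | yes _ = refl
    ... | no  _ | yes _ | no  _ | no  _ = refl
    ... | no  _ | yes _ | yes e | no ¬e = ⊥-elim (¬e (symm M e))
    ... | no  _ | yes _ | no ¬e | yes e = ⊥-elim (¬e (symm M e))
    ... | no  _ | no  _ | no  _ | _     = refl
    -- If neither index is smaller, the indices agree, so `e` would be a loop.
    ... | no ¬p | no ¬q | yes e | _     with Fin.<-cmp (index u) (index v)
    ...   | tri< p _ _ = ⊥-elim (¬p p)
    ...   | tri> _ _ q = ⊥-elim (¬q q)
    ...   | tri≈ _ r _ = ⊥-elim (irrefl M (subst (Adj M u) (sym (index-injective r)) e))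

  -- Where `M` has positive degree, that degree is 1, and `N` covers the vertex too, so its degree
  -- is at least 1. No bound on the degrees of `N` enters.
  degree-mono : ∀ M N → Functional M → (∀ {u} → Covers M u → Covers N u) →
                ∀ u → degree M u ≤ degree N u
  degree-mono M N fun cov u with 0 <? degree M u
  ... | yes 0<d = ≤-trans (degree≤1 M fun u) (covers⇒degree>0 N (cov (degree>0⇒covers M 0<d)))
  ... | no  0≮d = ≤-trans (≮⇒≥ 0≮d) z≤n

  card-mono-≤ : ∀ M N → Functional M → (∀ {u} → Covers M u → Covers N u) → card fin M ≤ card fin N
  card-mono-≤ M N fun cov = +-self-cancel-≤ (begin
    card fin M + card fin M ≡⟨ handshake M ⟩
    ∑ elements (degree M)   ≤⟨ ∑-mono-≤ elements (degree-mono M N fun cov) ⟩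
    ∑ elements (degree N)   ≡⟨ handshake N ⟨
    card fin N + card fin N ∎)
    where open ≤-Reasoning

  -- The degree sums differ strictly because at `a` the degree rises from 0 to a positive value;
  -- halving keeps the inequality strict.
  card-mono-< : ∀ M N → Functional M → (∀ {u} → Covers M u → Covers N u) →
                ∀ {a} → ¬ Covers M a → Covers N a → card fin M < card fin N
  card-mono-< M N fun cov {a} ¬Ma Na = +-self-cancel-< (begin-strict
    card fin M + card fin M ≡⟨ handshake M ⟩
    ∑ elements (degree M)   <⟨ ∑-mono-< (degree-mono M N fun cov) (∈-elements a) degree-< ⟩
    ∑ elements (degree N)   ≡⟨ handshake N ⟨
    card fin N + card fin N ∎)
    where
    open ≤-Reasoning
    degree-< : degree M a < degree N a
    degree-< = ≤-trans (s≤s (≮⇒≥ (¬Ma ∘′ degree>0⇒covers M))) (covers⇒degree>0 N Na)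

  sameEdge? : (e f : V × V) → Dec (SameEdge e f)
  sameEdge? (u , v) (u′ , v′) =
    ((u ≟ u′) ×-dec (v ≟ v′)) ⊎-dec ((u ≟ v′) ×-dec (v ≟ u′))

  addEdge : EdgeSet V → ∀ {a b} → a ≢ b → EdgeSet V
  addEdge M {a} {b} a≢b = record
    { Adj    = λ u v → Adj M u v ⊎ SameEdge (u , v) (a , b)
    ; symm   = λ { (inj₁ e)              → inj₁ (symm M e)
                 ; (inj₂ (inj₁ (p , q))) → inj₂ (inj₂ (q , p))
                 ; (inj₂ (inj₂ (p , q))) → inj₂ (inj₁ (q , p))
                 }
    ; irrefl = λ { (inj₁ e)              → irrefl M e
                 ; (inj₂ (inj₁ (p , q))) → a≢b (trans (sym p) q)
                 ; (inj₂ (inj₂ (p , q))) → a≢b (trans (sym q) p)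
                 }
    ; adj?   = λ u v → adj? M u v ⊎-dec sameEdge? (u , v) (a , b)
    }

  -- An old edge cannot meet the new one, since that would cover `a` or `b` by `M`. The new edge
  -- read in both directions from one vertex would force `a ≡ b`.
  addEdge-functional : ∀ M {a b} (a≢b : a ≢ b) → Functional M → ¬ Covers M a → ¬ Covers M b →
                       Functional (addEdge M a≢b)
  addEdge-functional M a≢b fun ¬a ¬b = λ where
    (inj₁ e) (inj₁ f)                                     → fun e f
    (inj₁ e) (inj₂ (inj₁ (refl , _)))                     → ⊥-elim (¬a (_ , e))
    (inj₁ e) (inj₂ (inj₂ (refl , _)))                     → ⊥-elim (¬b (_ , e))
    (inj₂ (inj₁ (refl , _))) (inj₁ f)                     → ⊥-elim (¬a (_ , f))
    (inj₂ (inj₂ (refl , _))) (inj₁ f)                     → ⊥-elim (¬b (_ , f))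
    (inj₂ (inj₁ (_ , refl))) (inj₂ (inj₁ (_ , refl)))     → refl
    (inj₂ (inj₂ (_ , refl))) (inj₂ (inj₂ (_ , refl)))     → refl
    (inj₂ (inj₁ (p , _))) (inj₂ (inj₂ (q , _)))           → ⊥-elim (a≢b (trans (sym p) q))
    (inj₂ (inj₂ (p , _))) (inj₂ (inj₁ (q , _)))           → ⊥-elim (a≢b (trans (sym q) p))

-- Matchings

module _ (G : Graph) where

  -- Two edges at `u` are not vertex-disjoint, so they cannot be distinct; decidability of
  -- `SameEdge` removes the double negation.
  matching⇒functional : ∀ M → IsMatching G M → Functional M
  matching⇒functional M m {u} {v} {w} e f
    with decidable-stable (sameEdge? (finite G) (u , v) (u , w))
           (λ ¬same → proj₁ (IsMatching.disjoint m e f ¬same) refl)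
  ... | inj₁ (_ , v≡w)   = v≡w
  ... | inj₂ (u≡w , v≡u) = trans v≡u u≡w

  -- There are four ways to share an end. Symmetry turns both edges to start at it, and then their
  -- other ends coincide.
  functional⇒matching : ∀ M → M ⊆ₑ E G → Functional M → IsMatching G M
  functional⇒matching M M⊆E fun = record
    { edges    = M⊆E
    ; disjoint = λ e f ¬same →
        (λ { refl → ¬same (inj₁ (refl , fun e f)) })
      , (λ { refl → ¬same (inj₂ (refl , fun e (symm M f))) })
      , (λ { refl → ¬same (inj₂ (fun (symm M e) f , refl)) })
      , (λ { refl → ¬same (inj₁ (fun (symm M e) (symm M f) , refl)) })
    }

  -- The inclusion of covered vertices is automatic for every competitor `N`.
  perfect⇒maximum : ∀ M → IsPerfectMatching G M → IsMaximumMatching G M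
  perfect⇒maximum M p = record
    { isMatching = isMatching
    ; largest    = λ N n → card-mono-≤ (finite G) N M (matching⇒functional N n) (λ {u} _ → covers u)
    }
    where open IsPerfectMatching p

  -- Otherwise the edge from `a` to `b` could be added, giving a larger matching.
  maximum⇒covers-edge : ∀ M → IsMaximumMatching G M →
                        ∀ {a b} → Adj (E G) a b → Covers M a ⊎ Covers M b
  maximum⇒covers-edge M max {a} {b} ab with covers? (finite G) M a | covers? (finite G) M b
  ... | yes ca | _      = inj₁ ca
  ... | no _   | yes cb = inj₂ cb
  ... | no ¬a  | no ¬b  = ⊥-elim (<⇒≱ larger (largest N N-matching))
    where
    open IsMaximumMatching max

    a≢b : a ≢ b
    a≢b refl = irrefl (E G) ab

    N : EdgeSet (V G)
    N = addEdge (finite G) M a≢b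

    M-functional : Functional M
    M-functional = matching⇒functional M isMatching

    N⊆E : N ⊆ₑ E G
    N⊆E (inj₁ e)                    = IsMatching.edges isMatching e
    N⊆E (inj₂ (inj₁ (refl , refl))) = ab
    N⊆E (inj₂ (inj₂ (refl , refl))) = symm (E G) ab

    N-matching : IsMatching G N
    N-matching = functional⇒matching N N⊆E
      (addEdge-functional (finite G) M a≢b M-functional ¬a ¬b)

    larger : card (finite G) M < card (finite G) N
    -- The growth is read off the covered vertices: `N` keeps all those of `M` and gains `a`.
    larger = card-mono-< (finite G) M N M-functional
      (λ (v , e) → v , inj₁ e) ¬a (b , inj₂ (inj₁ (refl , refl)))

-- Products

module _ (G H : Graph) where

  adj-fibreᴴ : ∀ ⋆ {g h h′} → Adj (E H) h h′ → Adj (E (G ⟨ ⋆ ⟩ H)) (g , h) (g , h′)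
  adj-fibreᴴ ⊠ f = inj₂ (inj₁ (refl , f))
  adj-fibreᴴ ∘ f = inj₂ (refl , f)

  adj-fibreᴳ : ∀ ⋆ {g g′ h} → Adj (E G) g g′ → Adj (E (G ⟨ ⋆ ⟩ H)) (g , h) (g′ , h)
  adj-fibreᴳ ⊠ e = inj₁ (e , refl)
  adj-fibreᴳ ∘ e = inj₁ e

  F⁎-edges : ∀ ⋆ MG MH → MG ⊆ₑ E G → MH ⊆ₑ E H → F⁎ MG MH ⊆ₑ E (G ⟨ ⋆ ⟩ H)
  F⁎-edges ⊠ MG MH MG⊆E MH⊆E (e , f) = inj₂ (inj₂ (MG⊆E e , MH⊆E f))
  F⁎-edges ∘ MG MH MG⊆E MH⊆E (e , f) = inj₁ (MG⊆E e)

F⁎-functional : ∀ (M : EdgeSet A) (N : EdgeSet B) → Functional M → Functional N → Functional (F⁎ M N)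
F⁎-functional M N funM funN (e , f) (e′ , f′) = cong₂ _,_ (funM e e′) (funN f f′)

-- Pairing both edges of `M` with one fixed edge of `N` lifts them to edges of `F⁎ M N` at a common
-- vertex. Without an edge in `N`, `F⁎ M N` is empty and says nothing about `M`.
F⁎-functionalˡ : ∀ (M : EdgeSet A) (N : EdgeSet B) → NonEmpty N → Functional (F⁎ M N) → Functional M
F⁎-functionalˡ M N (_ , _ , f) fun e e′ = cong proj₁ (fun (e , f) (e′ , f))

F⁎-functionalʳ : ∀ (M : EdgeSet A) (N : EdgeSet B) → NonEmpty M → Functional (F⁎ M N) → Functional N
F⁎-functionalʳ M N (_ , _ , e) fun f f′ = cong proj₂ (fun (e , f) (e , f′))

F⁎-coversˡ : ∀ (M : EdgeSet A) (N : EdgeSet B) {g h} → Covers (F⁎ M N) (g , h) → Covers M g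
F⁎-coversˡ M N ((g′ , _) , e , _) = g′ , e

F⁎-coversʳ : ∀ (M : EdgeSet A) (N : EdgeSet B) {g h} → Covers (F⁎ M N) (g , h) → Covers N h
F⁎-coversʳ M N ((_ , h′) , _ , f) = h′ , f

mainTheorem19 : (⋆ : ProductKind) (G H : Graph) →
    NonEmpty (E G) → NonEmpty (E H) →
    (MG : EdgeSet (V G)) (MH : EdgeSet (V H)) →
    MG ⊆ₑ E G → MH ⊆ₑ E H →
    (IsMaximumMatching (G ⟨ ⋆ ⟩ H) (F⁎ MG MH)
    ⇔ (IsPerfectMatching G MG × IsPerfectMatching H MH))
    × ((IsPerfectMatching G MG × IsPerfectMatching H MH)
    ⇔ IsPerfectMatching (G ⟨ ⋆ ⟩ H) (F⁎ MG MH))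
mainTheorem19 ⋆ G H (g₀ , g₁ , e₀) (h₀ , h₁ , f₀) MG MH MG⊆E MH⊆E =
  -- The passage from (2) to (1) goes through (3).
  mk⇔ maximum⇒factors (perfect⇒maximum GH F ∘′ factors⇒perfect) , mk⇔ factors⇒perfect perfect⇒factors
  where
  GH : Graph
  GH = G ⟨ ⋆ ⟩ H

  F : EdgeSet (V G × V H)
  F = F⁎ MG MH

  Factors : Set
  Factors = IsPerfectMatching G MG × IsPerfectMatching H MH

  factors⇒perfect : Factors → IsPerfectMatching GH F
  factors⇒perfect (pG , pH) = record
    { isMatching = functional⇒matching GH F (F⁎-edges G H ⋆ MG MH MG⊆E MH⊆E)
        (F⁎-functional MG MH (matching⇒functional G MG PG.isMatching)
                             (matching⇒functional H MH PH.isMatching))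
    ; covers     = λ (g , h) → let (g′ , e) = PG.covers g
                                   (h′ , f) = PH.covers h
                               in (g′ , h′) , e , f
    }
    where
    module PG = IsPerfectMatching pG
    module PH = IsPerfectMatching pH

  -- The common end of the arguments from (1) and from (3), which differ only in how the factors are
  -- shown to cover all vertices.
  covered-factors : IsMatching GH F → (∀ g → Covers MG g) → (∀ h → Covers MH h) → Factors
  covered-factors m covG covH =
      -- `MH` is not assumed non-empty: the edge required comes from covering the vertex `h₀`.
      record { isMatching = functional⇒matching G MG MG⊆E (F⁎-functionalˡ MG MH (h₀ , covH h₀) fun)
             ; covers     = covG }
    , record { isMatching = functional⇒matching H MH MH⊆E (F⁎-functionalʳ MG MH (g₀ , covG g₀) fun)
             ; covers     = covH }
    where
    fun : Functional F
    fun = matching⇒functional GH F m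

  perfect⇒factors : IsPerfectMatching GH F → Factors
  perfect⇒factors p = covered-factors isMatching
    (λ g → F⁎-coversˡ MG MH (covers (g , h₀))) (λ h → F⁎-coversʳ MG MH (covers (g₀ , h)))
    where open IsPerfectMatching p

  maximum⇒factors : IsMaximumMatching GH F → Factors
  maximum⇒factors max = covered-factors (IsMaximumMatching.isMatching max) coversG coversH
    where
    coversG : ∀ g → Covers MG g
    -- Both ends of this edge have first coordinate `g`, so it does not matter which one is covered.
    coversG g with maximum⇒covers-edge GH F max (adj-fibreᴴ G H ⋆ {g} f₀)
    ... | inj₁ c = F⁎-coversˡ MG MH c
    ... | inj₂ c = F⁎-coversˡ MG MH c

    coversH : ∀ h → Covers MH h
    coversH h with maximum⇒covers-edge GH F max (adj-fibreᴳ G H ⋆ {h = h} e₀)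
    ... | inj₁ c = F⁎-coversʳ MG MH c
    ... | inj₂ c = F⁎-coversʳ MG MH c
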